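{- The main Seidel eigenvalues of a hyperstar $S_n^k$ are $r_1$ and $r_2$, which are the roots of the equation $$\lambda^2-((k-1)(n-3)+1)\lambda-(n-1)(k-1)=0.$$
   Context: A hypergraph $G^*=(V,E)$ has a finite vertex set $V=\{v_1,\dots,v_N\}$ and a finite set $E$ of hyperedges, each a subset of $V$. Its adjacency matrix $A=(a_{ij})$ has $a_{ij}=|\{e\in E:\{v_i,v_j\}\subset e\}|$ for $i\ne j$ and $a_{ii}=0$. Its Seidel matrix is $S=J_N-I_N-2A$, where $J_N$ is the all-ones matrix and $I_N$ the identity matrix of order $N$. An eigenvalue of $S$ is called a main Seidel eigenvalue of $G^*$ if its eigenspace is not orthogonal to the all-ones vector $\mathbf{j}$, i.e. it has an eigenvector whose entries have nonzero sum. For $k\ge 2$, the hyperstar $S_n^k$ is the $k$-uniform hypergraph obtained from the star $S_n$ on $n$ vertices by adding $k-2$ new vertices to each edge: it has the $(n-1)(k-1)+1$ vertices $v_{0,0}$ and $v_{i,j}$ ($1\le i\le n-1$, $1\le j\le k-1$), and the $n-1$ hyperedges $\{v_{0,0},v_{i,1},\dots,v_{i,k-1}\}$, $1\le i\le n-1$.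
   Formalization: The formal theorem assumes n ≥ 3, which the English omits: for n = 2 the roots are 1 and -(k-1) but 1 is not a main Seidel eigenvalue, and for n = 1 the only main eigenvalue is 0 while the other root 3-2k is not an eigenvalue. -}

module Defs where

open import Level using (_⊔_) renaming (suc to lsuc)
open import Algebra.Apartness.Bundles using (HeytingField; HeytingCommutativeRing)
open import Algebra.Bundles using (CommutativeRing)
import Algebra.Definitions.RawMonoid as RawMonoidDefs
open import Data.Bool.Base using (if_then_else_)
open import Data.Fin.Base using (Fin; zero; suc; combine; fromℕ<)
open import Data.Fin.Properties using (_≟_; suc-injective; combine-injectiveˡ)
open import Data.Fin.Subset using (Subset; _∈_; ⁅_⁆; _∪_; ⋃)
open import Data.Fin.Subset.Properties
  using (_⊆?_; ∉⊥; x∈⁅x⁆; x∈⁅y⁆⇒x≡y; x∈p∪q⁺; x∈p∪q⁻)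
open import Data.List.Base using (List; []; _∷_; map; allFin; filter; length)
open import Data.List.Relation.Unary.Unique.Propositional using (Unique)
import Data.List.Relation.Unary.Unique.Propositional.Properties as Uniqueₚ
open import Data.List.Membership.Propositional.Properties using (∈-allFin)
import Data.List.Membership.Propositional as List
open import Data.List.Relation.Unary.Any using (here; there)
open import Data.Nat.Base as ℕ using (ℕ; suc; _∸_)
open import Data.Nat.Properties using (∸-monoˡ-≤)
open import Data.Product.Base using (∃-syntax; _×_; _,_)
open import Data.Sum.Base using (_⊎_; inj₁; inj₂)
open import Data.Vec.Functional using (Vector)
open import Function.Bundles using (_⇔_)
open import Relation.Binary.Core using (Rel)
open import Relation.Binary.PropositionalEquality.Core
  using (_≡_; refl; subst)
open import Relation.Binary.Structures using (IsStrictPartialOrder)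
open import Relation.Nullary using (yes; no; does; contradiction)

------------------------------------------------------------------------
-- The real numbers

-- A model of the reals is a Cauchy-complete Archimedean ordered field.
-- Classically these axioms determine ℝ up to unique isomorphism, and they
-- are also satisfied by the constructive (Cauchy) reals.
record RealField c ℓ₁ ℓ₂ : Set (lsuc (c ⊔ ℓ₁ ⊔ ℓ₂)) where
  infix 4 _<_
  field
    heytingField : HeytingField c ℓ₁ ℓ₂

  open HeytingField heytingField public

  commutativeRing : CommutativeRing c ℓ₁
  commutativeRing = HeytingCommutativeRing.commutativeRing heytingCommutativeRing

  open RawMonoidDefs (CommutativeRing.+-rawMonoid commutativeRing) public
    using (sum) renaming (_×_ to _·_)

  fromℕ : ℕ → Carrier
  fromℕ n = n · 1#

  field
    _<_                  : Rel Carrier ℓ₂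
    isStrictPartialOrder : IsStrictPartialOrder _≈_ _<_
    #⇔<⊎>                : ∀ x y → (x # y) ⇔ (x < y ⊎ y < x)
    +-monoˡ-<            : ∀ {x y} z → x < y → x + z < y + z
    *-pos                : ∀ {x y} → 0# < x → 0# < y → 0# < x * y
    archimedean          : ∀ x → ∃[ n ] x < fromℕ n

  -- One inequality suffices, since m and n range symmetrically.
  IsCauchy : (ℕ → Carrier) → Set (c ⊔ ℓ₂)
  IsCauchy s = ∀ ε → 0# < ε →
    ∃[ N ] (∀ m n → N ℕ.≤ m → N ℕ.≤ n → s m < s n + ε)

  _ConvergesTo_ : (ℕ → Carrier) → Carrier → Set (c ⊔ ℓ₂)
  s ConvergesTo l = ∀ ε → 0# < ε →
    ∃[ N ] (∀ n → N ℕ.≤ n → (s n < l + ε) × (l < s n + ε))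

  field
    complete : ∀ s → IsCauchy s → ∃[ l ] (s ConvergesTo l)

------------------------------------------------------------------------
-- Hypergraphs

-- The vertex set is Fin order; the finite set of hyperedges is a list of
-- subsets without repetitions.
record Hypergraph : Set where
  field
    order  : ℕ
    edges  : List (Subset order)
    unique : Unique edges

open Hypergraph public

adjacency : (G : Hypergraph) → Fin (order G) → Fin (order G) → ℕ
adjacency G i j with i ≟ j
... | yes _ = 0
... | no  _ = length (filter ((⁅ i ⁆ ∪ ⁅ j ⁆) ⊆?_) (edges G))

------------------------------------------------------------------------
-- Seidel matrix and main Seidel eigenvalues

module Spectral {c ℓ₁ ℓ₂} (ℝ : RealField c ℓ₁ ℓ₂) where
  open RealField ℝ using (Carrier; _≈_; _#_; _+_; _*_; _-_; 0#; 1#; fromℕ; sum)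

  Matrix : ℕ → Set c
  Matrix N = Fin N → Fin N → Carrier

  J : ∀ N → Matrix N
  J N i j = 1#

  I : ∀ N → Matrix N
  I N i j = if does (i ≟ j) then 1# else 0#

  seidel : (G : Hypergraph) → Matrix (order G)
  seidel G i j =
    (J (order G) i j - I (order G) i j) - fromℕ 2 * fromℕ (adjacency G i j)

  -- x # y (apartness) is the positive form of x ≠ y.
  IsEigenvector : ∀ {N} → Matrix N → Carrier → Vector Carrier N → Set (ℓ₁ ⊔ ℓ₂)
  IsEigenvector M λ′ v =
    (∃[ i ] v i # 0#) × (∀ i → sum (λ j → M i j * v j) ≈ λ′ * v i)

  IsMainSeidelEigenvalue : Hypergraph → Carrier → Set (c ⊔ ℓ₁ ⊔ ℓ₂)
  IsMainSeidelEigenvalue G λ′ =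
    ∃[ v ] (IsEigenvector (seidel G) λ′ v × sum v # 0#)

------------------------------------------------------------------------
-- Hyperstars

-- There are p branches with q vertices each, i.e. p = n - 1 and q = k - 1.
module _ {p q : ℕ} where

  centre : Fin (suc (p ℕ.* q))
  centre = zero

  leaf : Fin p → Fin q → Fin (suc (p ℕ.* q))
  leaf i j = suc (combine i j)

  branch : Fin p → Subset (suc (p ℕ.* q))
  branch i = ⁅ centre ⁆ ∪ ⋃ (map (λ j → ⁅ leaf i j ⁆) (allFin q))

  private
    ∈-⋃⁺ : ∀ i {j} (js : List (Fin q)) → j List.∈ js →
           leaf i j ∈ ⋃ (map (λ j → ⁅ leaf i j ⁆) js)
    ∈-⋃⁺ i (j ∷ js) (here refl)  = x∈p∪q⁺ (inj₁ (x∈⁅x⁆ (leaf i j)))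
    ∈-⋃⁺ i (_ ∷ js) (there j∈js) = x∈p∪q⁺ (inj₂ (∈-⋃⁺ i js j∈js))

    ∈-⋃⁻ : ∀ i {x} (js : List (Fin q)) →
           x ∈ ⋃ (map (λ j → ⁅ leaf i j ⁆) js) → ∃[ j ] x ≡ leaf i j
    ∈-⋃⁻ i []       x∈ = contradiction x∈ ∉⊥
    ∈-⋃⁻ i (j ∷ js) x∈ with x∈p∪q⁻ ⁅ leaf i j ⁆ _ x∈
    ... | inj₁ x∈j  = j , x∈⁅y⁆⇒x≡y (leaf i j) x∈j
    ... | inj₂ x∈js = ∈-⋃⁻ i js x∈js

  leaf∈branch : ∀ i j → leaf i j ∈ branch i
  leaf∈branch i j = x∈p∪q⁺ (inj₂ (∈-⋃⁺ i (allFin q) (∈-allFin j)))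

  leaf∈branch⁻ : ∀ i i′ j → leaf i j ∈ branch i′ → i ≡ i′
  leaf∈branch⁻ i i′ j l∈ with x∈p∪q⁻ ⁅ centre ⁆ _ l∈
  ... | inj₁ l∈c with () ← x∈⁅y⁆⇒x≡y centre l∈c
  ... | inj₂ l∈⋃ with j′ , eq ← ∈-⋃⁻ i′ (allFin q) l∈⋃ =
    combine-injectiveˡ i j i′ j′ (suc-injective eq)

  -- The vertex of a branch supplied here rules out q = 0, where all
  -- branches would coincide.
  branch-injective : Fin q → ∀ {i i′} → branch i ≡ branch i′ → i ≡ i′
  branch-injective j {i} {i′} eq =
    leaf∈branch⁻ i i′ j (subst (leaf i j ∈_) eq (leaf∈branch i j))

hyperstar : (n k : ℕ) → 2 ℕ.≤ k → Hypergraph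
hyperstar n k 2≤k = record
  { order  = suc ((n ∸ 1) ℕ.* (k ∸ 1))
  ; edges  = map branch (allFin (n ∸ 1))
  ; unique = Uniqueₚ.map⁺ (branch-injective (fromℕ< (∸-monoˡ-≤ 1 2≤k)))
                         (Uniqueₚ.allFin⁺ (n ∸ 1))
  }

{-# OPTIONS --safe #-}
module Submission where

-- Put p = n - 1, q = k - 1, b = pq and a = (p - 2)q + 1. Every leaf row of the
-- Seidel matrix, and by symmetry every leaf column, has leaf part summing to a.
-- If v is an eigenvector for λ with centre entry x and leaf entries summing
-- to T, then the centre row gives λx = -T and the sum of the leaf rows gives
-- λT = aT - bx; hence (λ² - aλ - b)(x + T) = 0, where x + T is the entry sum.
-- Conversely, for a root λ the vector with centre entry a - λ and all leaf
-- entries 1 is an eigenvector, with entry sum a + b - λ; this is nonzero since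
-- the polynomial takes the value b(a + b - 1) > 0 at a + b.
--
-- The roots need the square root of the natural number a² + 4b, obtained as
-- the limit of ⌊√(m N²)⌋ / N, whose error is below 1/N.

open import Defs
open import Algebra.Bundles using (CommutativeRing)
import Algebra.Apartness.Properties.HeytingCommutativeRing as HeytingProperties
import Algebra.Properties.AbelianGroup as AbelianGroupProperties
import Algebra.Properties.CommutativeSemigroup as CommutativeSemigroupProperties
import Algebra.Properties.Ring as RingProperties
import Algebra.Properties.Semiring.Mult as SemiringMult
import Algebra.Properties.Semiring.Mult.TCOptimised as TCOptimisedMult
import Algebra.Properties.Semiring.Sum as SemiringSum
import Algebra.Solver.Ring as RingSolver
open import Algebra.Solver.Ring.AlmostCommutativeRing
  using (fromCommutativeRing; _-Raw-AlmostCommutative⟶_)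
open import Data.Bool.Base using (if_then_else_)
open import Data.Fin.Base using (Fin; zero; suc; combine; remQuot; quotient; _↑ˡ_; _↑ʳ_)
open import Data.Fin.Properties using (_≟_; suc-injective; combine-remQuot; remQuot-combine)
open import Data.Fin.Subset using (Subset; _∈_; ⁅_⁆; _∪_; _⊆_)
open import Data.Fin.Subset.Properties
  using (_⊆?_; x∈⁅x⁆; x∈⁅y⁆⇒x≡y; x∈p∪q⁺; x∈p∪q⁻)
open import Data.Integer.Base as ℤ using (ℤ; +_; -[1+_]; _⊖_; _◃_; sign; ∣_∣)
import Data.Integer.Properties as ℤ
open import Data.List.Base using (_∷_; filter; length)
import Data.List.Membership.Propositional as List
open import Data.List.Membership.Propositional.Properties using (∈-allFin; ∈-map⁺; ∈-map⁻)
open import Data.List.Properties using (filter-none; filter-accept; filter-reject)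
open import Data.List.Relation.Unary.All as All using ()
open import Data.List.Relation.Unary.AllPairs using (_∷_)
open import Data.List.Relation.Unary.Any using (here; there)
open import Data.List.Relation.Unary.Unique.Propositional using (Unique)
open import Data.Maybe.Base as Maybe using (Maybe)
open import Data.Nat.Base as ℕ using (ℕ; zero; suc; _≤_; s≤s; z≤n)
import Data.Nat.Properties as ℕ
open import Data.Nat.Solver using (module +-*-Solver)
open import Data.Product.Base using (∃-syntax; _×_; _,_; proj₁; proj₂)
open import Data.Sign.Base as Sign using (Sign)
open import Data.Sum.Base as Sum using (_⊎_; inj₁; inj₂; [_,_]′)
open import Data.Vec.Functional using (Vector)
open import Function.Base using (_$_; _∘_)
open import Function.Bundles using (_⇔_; mk⇔; Equivalence)
open import Relation.Binary.PropositionalEquality.Core as ≡ using (_≡_; _≢_)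
import Relation.Binary.Reasoning.Setoid as ≈-Reasoning
open import Relation.Binary.Structures using (IsStrictPartialOrder)
open import Relation.Nullary using (Dec; yes; no; does; ¬_; contradiction)
open import Relation.Nullary.Decidable using (does-⇔; dec⇒maybe)
open import Relation.Unary using (Pred; Decidable)

-- A ring solver with integer coefficients for commutative rings.

module IntegerCoefficients {c ℓ} (R : CommutativeRing c ℓ) where
  open CommutativeRing R
  open RingProperties ring
  open AbelianGroupProperties +-abelianGroup using (⁻¹-∙-comm)
  open TCOptimisedMult semiring renaming (_×_ to _·_) using (1+×; ×-homo-+; ×1-homo-*)
  open CommutativeSemigroupProperties *-commutativeSemigroup using (interchange)
  open ≈-Reasoning setoid

  -- The multiples are the optimised ones, for which `1 · 1#` computes to `1#`. Hence `con (+ 1)`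
  -- and `con (+ 2)` in solver equations unfold to `1#` and `1# + 1#`.
  fromℤ : ℤ → Carrier
  fromℤ (+ n)    = n · 1#
  fromℤ -[1+ n ] = - (suc n · 1#)

  fromℤ-⊖ : ∀ m n → fromℤ (m ⊖ n) ≈ m · 1# - n · 1#
  fromℤ-⊖ zero    zero    = sym (-‿inverseʳ 0#)
  fromℤ-⊖ zero    (suc n) = sym (+-identityˡ _)
  fromℤ-⊖ (suc m) zero    = sym (trans (+-congˡ -0#≈0#) (+-identityʳ _))
  fromℤ-⊖ (suc m) (suc n) = begin
    fromℤ (suc m ⊖ suc n)                  ≡⟨ ≡.cong fromℤ (ℤ.[1+m]⊖[1+n]≡m⊖n m n) ⟩
    fromℤ (m ⊖ n)                          ≈⟨ fromℤ-⊖ m n ⟩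
    m · 1# - n · 1#                        ≈⟨ +-congʳ (xyx⁻¹≈y 1# (m · 1#)) ⟨
    1# + m · 1# - 1# - n · 1#              ≈⟨ +-assoc _ _ _ ⟩
    1# + m · 1# + (- 1# - n · 1#)          ≈⟨ +-congˡ (⁻¹-∙-comm 1# (n · 1#)) ⟩
    1# + m · 1# - (1# + n · 1#)            ≈⟨ +-cong (1+× m 1#) (-‿cong (1+× n 1#)) ⟨
    suc m · 1# - suc n · 1#                ∎

  fromℤ-+ : ∀ i j → fromℤ (i ℤ.+ j) ≈ fromℤ i + fromℤ j
  fromℤ-+ (+ m)    (+ n)    = ×-homo-+ 1# m n
  fromℤ-+ (+ m)    -[1+ n ] = fromℤ-⊖ m (suc n)
  fromℤ-+ -[1+ m ] (+ n)    = trans (fromℤ-⊖ n (suc m)) (+-comm _ _)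
  fromℤ-+ -[1+ m ] -[1+ n ] = begin
    - (suc (suc (m ℕ.+ n)) · 1#)     ≡⟨ ≡.cong (λ k → - (suc k · 1#)) (ℕ.+-suc m n) ⟨
    - ((suc m ℕ.+ suc n) · 1#)       ≈⟨ -‿cong (×-homo-+ 1# (suc m) (suc n)) ⟩
    - (suc m · 1# + suc n · 1#)      ≈⟨ ⁻¹-∙-comm _ _ ⟨
    - (suc m · 1#) - suc n · 1#      ∎

  fromSign : Sign → Carrier
  fromSign Sign.+ = 1#
  fromSign Sign.- = - 1#

  fromSign-* : ∀ s t → fromSign (s Sign.* t) ≈ fromSign s * fromSign t
  fromSign-* Sign.+ t      = sym (*-identityˡ _)
  fromSign-* Sign.- Sign.+ = sym (*-identityʳ _)
  fromSign-* Sign.- Sign.- = sym (trans (-1*x≈-x (- 1#)) (-‿involutive 1#))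

  fromℤ-◃ : ∀ s n → fromℤ (s ◃ n) ≈ fromSign s * n · 1#
  fromℤ-◃ s      zero    = sym (zeroʳ _)
  fromℤ-◃ Sign.+ (suc n) = sym (*-identityˡ _)
  fromℤ-◃ Sign.- (suc n) = sym (-1*x≈-x _)

  fromℤ-sign-abs : ∀ i → fromℤ i ≈ fromSign (sign i) * ∣ i ∣ · 1#
  fromℤ-sign-abs i = trans (reflexive (≡.cong fromℤ (≡.sym (ℤ.signᵢ◃∣i∣≡i i))))
                           (fromℤ-◃ (sign i) ∣ i ∣)

  -- Integer multiplication is defined through signs and absolute values, so both factors are split
  -- that way and the four resulting terms regrouped.
  fromℤ-* : ∀ i j → fromℤ (i ℤ.* j) ≈ fromℤ i * fromℤ j
  fromℤ-* i j = begin
    fromℤ (s Sign.* t ◃ m ℕ.* n)                     ≈⟨ fromℤ-◃ (s Sign.* t) (m ℕ.* n) ⟩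
    fromSign (s Sign.* t) * (m ℕ.* n) · 1#           ≈⟨ *-cong (fromSign-* s t) (×1-homo-* m n) ⟩
    (fromSign s * fromSign t) * (m · 1# * n · 1#)    ≈⟨ interchange _ _ _ _ ⟩
    (fromSign s * m · 1#) * (fromSign t * n · 1#)    ≈⟨ *-cong (fromℤ-sign-abs i) (fromℤ-sign-abs j) ⟨
    fromℤ i * fromℤ j                                ∎
    where
    s = sign i
    t = sign j
    m = ∣ i ∣
    n = ∣ j ∣

  fromℤ-neg : ∀ i → fromℤ (ℤ.- i) ≈ - fromℤ i
  fromℤ-neg (+ zero)  = sym -0#≈0#
  fromℤ-neg (+ suc n) = refl
  fromℤ-neg -[1+ n ]  = sym (-‿involutive _)

  fromℤ-morphism : ℤ.+-*-rawRing -Raw-AlmostCommutative⟶ fromCommutativeRing R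
  fromℤ-morphism = record
    { ⟦_⟧    = fromℤ
    ; +-homo = fromℤ-+
    ; *-homo = fromℤ-*
    ; -‿homo = fromℤ-neg
    ; 0-homo = refl
    ; 1-homo = refl
    }

  -- Comparing the integers is enough: the solver asks only for sufficient evidence that two
  -- coefficients agree, and equality in `R` need not be decidable.
  fromℤ-≟ : ∀ i j → Maybe (fromℤ i ≈ fromℤ j)
  fromℤ-≟ i j = Maybe.map (reflexive ∘ ≡.cong fromℤ) (dec⇒maybe (i ℤ.≟ j))

  module Solver = RingSolver ℤ.+-*-rawRing (fromCommutativeRing R) fromℤ-morphism fromℤ-≟

-- Ordered field arithmetic and the Archimedean property.

module OrderedField {c ℓ₁ ℓ₂} (ℝ : RealField c ℓ₁ ℓ₂) where
  open RealField ℝ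
  open CommutativeRing commutativeRing using (semiring)
  open HeytingProperties heytingCommutativeRing public using (1#0; #-congʳ)
  open IntegerCoefficients commutativeRing public using (module Solver)
  open Solver public using (solve; con; _:=_; _:+_; _:*_; _:-_; :-_)
  open ≈-Reasoning setoid
  open IsStrictPartialOrder isStrictPartialOrder public
    using () renaming (irrefl to <-irrefl; trans to <-trans; asym to <-asym)

  <-respˡ : ∀ {x y z} → x ≈ y → x < z → y < z
  <-respˡ = proj₂ (IsStrictPartialOrder.<-resp-≈ isStrictPartialOrder)

  <-respʳ : ∀ {x y z} → x ≈ y → z < x → z < y
  <-respʳ = proj₁ (IsStrictPartialOrder.<-resp-≈ isStrictPartialOrder)

  x<y⇒0<y-x : ∀ {x y} → x < y → 0# < y - x
  x<y⇒0<y-x {x} x<y = <-respˡ (-‿inverseʳ x) (+-monoˡ-< (- x) x<y)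

  -- Reduces an inequality to a known one through a ring identity between the differences, which the
  -- solver can check. Most estimates below take this form.
  <-shift : ∀ {x y u v} → y - x ≈ v - u → x < y → u < v
  <-shift {x} {y} {u} {v} eq x<y = <-respˡ (+-identityˡ u) $
    <-respʳ (trans (+-congʳ eq) (solve 2 (λ u v → v :- u :+ u := v) refl u v))
      (+-monoˡ-< u (x<y⇒0<y-x x<y))

  +-mono-< : ∀ {x y u v} → x < y → u < v → x + u < y + v
  +-mono-< {x} {y} {u} {v} x<y u<v = <-trans (+-monoˡ-< u x<y)
    (<-shift (solve 3 (λ y u v → v :- u := y :+ v :- (y :+ u)) refl y u v) u<v)

  +-pos : ∀ {x y} → 0# < x → 0# < y → 0# < x + y
  +-pos 0<x 0<y = <-respˡ (+-identityʳ 0#) (+-mono-< 0<x 0<y)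

  *-monoʳ-< : ∀ {x y} z → 0# < z → x < y → x * z < y * z
  *-monoʳ-< {x} {y} z 0<z x<y = <-shift
    (solve 3 (λ x y z → (y :- x) :* z :- con (+ 0) := y :* z :- x :* z) refl x y z)
    (*-pos (x<y⇒0<y-x x<y) 0<z)

  <⇒# : ∀ {x y} → x < y → x # y
  <⇒# {x} {y} x<y = Equivalence.from (#⇔<⊎> x y) (inj₁ x<y)

  #⇒<⊎> : ∀ {x y} → x # y → x < y ⊎ y < x
  #⇒<⊎> {x} {y} = Equivalence.to (#⇔<⊎> x y)

  0<⇒#0 : ∀ {x} → 0# < x → x # 0#
  0<⇒#0 0<x = #-sym (<⇒# 0<x)

  -- Apartness of 1 from 0 leaves two cases; if 1 were negative, then -1 would be positive and so
  -- would its square, which is 1.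
  0<1 : 0# < 1#
  0<1 with #⇒<⊎> 1#0
  ... | inj₂ 0<1 = 0<1
  ... | inj₁ 1<0 = <-respʳ (solve 0 (:- con (+ 1) :* (:- con (+ 1)) := con (+ 1)) refl) (*-pos 0<-1 0<-1)
    where
    0<-1 : 0# < - 1#
    0<-1 = <-shift (solve 0 (con (+ 0) :- con (+ 1) := :- con (+ 1) :- con (+ 0)) refl) 1<0

  -- By tightness of apartness. Equalities of limits are proved this way, since the order is not
  -- assumed decidable.
  ≮≯⇒≈ : ∀ {x y} → ¬ (x < y) → ¬ (y < x) → x ≈ y
  ≮≯⇒≈ {x} {y} x≮y y≮x = proj₁ (tight x y) (λ x#y → [ x≮y , y≮x ]′ (#⇒<⊎> x#y))

  fromℕ-+ : ∀ m n → fromℕ (m ℕ.+ n) ≈ fromℕ m + fromℕ n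
  fromℕ-+ = SemiringMult.×-homo-+ semiring 1#

  fromℕ-* : ∀ m n → fromℕ (m ℕ.* n) ≈ fromℕ m * fromℕ n
  fromℕ-* = SemiringMult.×1-homo-* semiring

  0<fromℕ : ∀ n .{{_ : ℕ.NonZero n}} → 0# < fromℕ n
  0<fromℕ (suc zero)      = <-respʳ (sym (+-identityʳ 1#)) 0<1
  0<fromℕ (suc n@(suc _)) = +-pos 0<1 (0<fromℕ n)

  fromℕ-mono-< : ∀ {m n} → m ℕ.< n → fromℕ m < fromℕ n
  fromℕ-mono-< {zero}  {suc n} _           = 0<fromℕ (suc n)
  fromℕ-mono-< {suc m} {suc n} (s≤s m<n) = <-shift
    (solve 2 (λ x y → y :- x := con (+ 1) :+ y :- (con (+ 1) :+ x)) refl (fromℕ m) (fromℕ n))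
    (fromℕ-mono-< m<n)

  #0⇒inverse : ∀ {x} → x # 0# → ∃[ y ] x * y ≈ 1#
  #0⇒inverse {x} x#0 with y , _ , eq ← #⇒invertible x#0 =
    y , trans (solve 2 (λ x y → x :* y := (x :- con (+ 0)) :* y) refl x y) eq

  inverse⇒#0 : ∀ {x} y → x * y ≈ 1# → x # 0#
  inverse⇒#0 {x} y eq = HeytingProperties.invertibleʳ⇒# heytingCommutativeRing
    (y , trans (solve 2 (λ x y → (x :- con (+ 0)) :* y := x :* y) refl x y) eq)

  x*y#0⇒x#0 : ∀ {x} y → x * y # 0# → x # 0#
  x*y#0⇒x#0 y xy#0 with z , eq ← #0⇒inverse xy#0 =
    inverse⇒#0 (y * z) (trans (sym (*-assoc _ y z)) eq)

  x#0∧x*y≈0⇒y≈0 : ∀ {x y} → x # 0# → x * y ≈ 0# → y ≈ 0#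
  x#0∧x*y≈0⇒y≈0 {x} {y} x#0 xy≈0 with z , xz≈1 ← #0⇒inverse x#0 = begin
    y            ≈⟨ *-identityˡ y ⟨
    1# * y       ≈⟨ *-congʳ xz≈1 ⟨
    x * z * y    ≈⟨ solve 3 (λ x y z → x :* z :* y := z :* (x :* y)) refl x y z ⟩
    z * (x * y)  ≈⟨ *-congˡ xy≈0 ⟩
    z * 0#       ≈⟨ zeroʳ z ⟩
    0#           ∎

  -- The inverse is itself invertible, hence apart from zero and of definite sign; a negative one
  -- would make the product 1 negative.
  0<⇒inverse : ∀ {x} → 0# < x → ∃[ y ] (0# < y × x * y ≈ 1#)
  0<⇒inverse {x} 0<x with y , xy≈1 ← #0⇒inverse (0<⇒#0 0<x)
    with #⇒<⊎> (inverse⇒#0 x (trans (*-comm y x) xy≈1))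
  ... | inj₂ 0<y = y , 0<y , xy≈1
  ... | inj₁ y<0 = contradiction 1<0 (<-asym 0<1)
    where
    1<0 : 1# < 0#
    1<0 = <-respˡ (trans (*-comm y x) xy≈1) (<-respʳ (zeroˡ x) (*-monoʳ-< x 0<x y<0))

  half : ∃[ h ] (1# + 1#) * h ≈ 1#
  half = #0⇒inverse (0<⇒#0 (+-pos 0<1 0<1))

  -- Removes the factor 2 that enters through `*-bound`.
  double-injective : ∀ {x y} → x + x ≈ y + y → x ≈ y
  double-injective {x} {y} 2x≈2y =
    let h , 2h≈1 = half
        halve z  = trans (solve 2 (λ z h → (z :+ z) :* h := z :* (con (+ 2) :* h)) refl z h)
                         (trans (*-congˡ 2h≈1) (*-identityʳ z))
    in trans (sym (halve x)) (trans (*-congʳ 2x≈2y) (halve y))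

  abstract
    -- Indexed with a shift, so that the denominator is never zero; `abstract` keeps the
    -- construction of the inverse from unfolding in later terms.
    1/1+ : ℕ → Carrier
    1/1+ n = proj₁ (0<⇒inverse (0<fromℕ (suc n)))

    0<1/1+ : ∀ n → 0# < 1/1+ n
    0<1/1+ n = proj₁ (proj₂ (0<⇒inverse (0<fromℕ (suc n))))

    fromℕ-1/1+ : ∀ n → fromℕ (suc n) * 1/1+ n ≈ 1#
    fromℕ-1/1+ n = proj₂ (proj₂ (0<⇒inverse (0<fromℕ (suc n))))

  -- The Archimedean property gives N above δ = 1/ε; multiplying δ < n + 1 by ε/(n + 1) yields the
  -- bound.
  1/1+-small : ∀ {ε} → 0# < ε → ∃[ N ] (∀ n → N ℕ.≤ n → 1/1+ n < ε)
  1/1+-small {ε} 0<ε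
    with δ , 0<δ , εδ≈1 ← 0<⇒inverse 0<ε
    with N , δ<N ← archimedean δ = N , λ n N≤n →
      <-respˡ (eq₁ n) (<-respʳ (eq₂ n)
        (*-monoʳ-< (ε * 1/1+ n) (*-pos 0<ε (0<1/1+ n)) (<-trans δ<N (fromℕ-mono-< (s≤s N≤n)))))
    where
    eq₁ : ∀ n → δ * (ε * 1/1+ n) ≈ 1/1+ n
    eq₁ n = begin
      δ * (ε * 1/1+ n)  ≈⟨ solve 3 (λ d e i → d :* (e :* i) := e :* d :* i) refl δ ε (1/1+ n) ⟩
      ε * δ * 1/1+ n    ≈⟨ *-congʳ εδ≈1 ⟩
      1# * 1/1+ n       ≈⟨ *-identityˡ _ ⟩
      1/1+ n            ∎
    eq₂ : ∀ n → fromℕ (suc n) * (ε * 1/1+ n) ≈ ε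
    eq₂ n = begin
      fromℕ (suc n) * (ε * 1/1+ n)  ≈⟨ solve 3 (λ a e i → a :* (e :* i) := a :* i :* e) refl (fromℕ (suc n)) ε (1/1+ n) ⟩
      fromℕ (suc n) * 1/1+ n * ε    ≈⟨ *-congʳ (fromℕ-1/1+ n) ⟩
      1# * ε                        ≈⟨ *-identityˡ ε ⟩
      ε                             ∎

  -- If y < x, some 1/(n + 1) lies below both 1 and (x - y)/C, and taking it for ε gives x < y + Cε
  -- < x. Restricting to ε < 1 allows the estimates to bound quadratic error terms linearly.
  <-margin⇒≮ : ∀ {x y C} → 0# < C →
               (∀ ε → 0# < ε → ε < 1# → x < y + C * ε) → ¬ (y < x)
  <-margin⇒≮ {x} {y} {C} 0<C x<y+Cε y<x =
    let D , 0<D , CD≈1 = 0<⇒inverse 0<C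
        N₁ , small₁    = 1/1+-small (*-pos 0<D (x<y⇒0<y-x y<x))
        N₂ , small₂    = 1/1+-small 0<1
        n              = N₁ ℕ.⊔ N₂
    in absurd D CD≈1 (1/1+ n) (0<1/1+ n) (small₁ n (ℕ.m≤m⊔n N₁ N₂)) (small₂ n (ℕ.m≤n⊔m N₁ N₂))
    where
    absurd : ∀ D → C * D ≈ 1# → ∀ ε → 0# < ε → ε < D * (x - y) → ¬ (ε < 1#)
    absurd D CD≈1 ε 0<ε ε<D[x-y] ε<1 = <-irrefl refl (<-trans (x<y+Cε ε 0<ε ε<1) y+Cε<x)
      where
      eq : D * (x - y) * C - ε * C ≈ x - (y + C * ε)
      eq = begin
        D * (x - y) * C - ε * C   ≈⟨ solve 5 (λ c d e x y → d :* (x :- y) :* c :- e :* c := c :* d :* (x :- y) :- c :* e) refl C D ε x y ⟩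
        C * D * (x - y) - C * ε   ≈⟨ +-congʳ (*-congʳ CD≈1) ⟩
        1# * (x - y) - C * ε      ≈⟨ solve 4 (λ c e x y → con (+ 1) :* (x :- y) :- c :* e := x :- (y :+ c :* e)) refl C ε x y ⟩
        x - (y + C * ε)           ∎
      y+Cε<x : y + C * ε < x
      y+Cε<x = <-shift eq (*-monoʳ-< C 0<C ε<D[x-y])

  -- (a - x)(y + b) + (x + a)(b - y) = 2(ab - xy)
  *-bound : ∀ {x y a b} → - a < x → x < a → - b < y → y < b → x * y + x * y < a * b + a * b
  *-bound {x} {y} {a} {b} -a<x x<a -b<y y<b = <-shift
    (solve 4 (λ x y a b → ((a :- x) :* (y :- :- b)) :+ ((x :- :- a) :* (b :- y)) :- (con (+ 0) :+ con (+ 0))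
                := a :* b :+ a :* b :- (x :* y :+ x :* y)) refl x y a b)
    (+-mono-< (*-pos (x<y⇒0<y-x x<a) (x<y⇒0<y-x -b<y))
              (*-pos (x<y⇒0<y-x -a<x) (x<y⇒0<y-x y<b)))

-- Integer square roots.

module FloorSqrt where
  open import Data.Nat.Base using (_<_; _+_; _*_)

  square-cancel-< : ∀ {m n} → m * m < n * n → m < n
  square-cancel-< m²<n² = ℕ.≰⇒> λ n≤m → ℕ.<⇒≱ m²<n² (ℕ.*-mono-≤ n≤m n≤m)

  -- By induction on `n`. From n < (r + 1)² follows n + 1 < (r + 2)², so the root grows by at most
  -- one, and one comparison decides whether it does.
  floorSqrt : ∀ n → ∃[ r ] (r * r ≤ n × n < suc r * suc r)
  floorSqrt zero = 0 , z≤n , s≤s z≤n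
  floorSqrt (suc n) with r , r²≤n , n<[1+r]² ← floorSqrt n | ℕ.≤-<-connex (suc r * suc r) (suc n)
  ... | inj₁ [1+r]²≤1+n = suc r , [1+r]²≤1+n ,
          ℕ.<-≤-trans (s≤s n<[1+r]²) (ℕ.*-mono-< {suc r} {suc (suc r)} ℕ.≤-refl ℕ.≤-refl)
  ... | inj₂ 1+n<[1+r]² = r , ℕ.m≤n⇒m≤1+n r²≤n , 1+n<[1+r]²

  module _ (m : ℕ) where

    -- root n / suc n ≤ √m < (root n + 1) / suc n
    root : ℕ → ℕ
    root n = proj₁ (floorSqrt (m * (suc n * suc n)))

    root-lower : ∀ n → root n * root n ≤ m * (suc n * suc n)
    root-lower n = proj₁ (proj₂ (floorSqrt (m * (suc n * suc n))))

    root-upper : ∀ n → m * (suc n * suc n) < suc (root n) * suc (root n)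
    root-upper n = proj₂ (proj₂ (floorSqrt (m * (suc n * suc n))))

    -- Both fractions are compared with √m: the one at k does not exceed it, the one at n with
    -- numerator raised by 1 does. Squaring and clearing denominators keeps this within the natural
    -- numbers.
    root-cross : ∀ k n → root k * suc n < suc (root n) * suc k
    root-cross k n = square-cancel-< $ begin-strict
      root k * suc n * (root k * suc n)                ≡⟨ ℕ.[m*n]*[o*p]≡[m*o]*[n*p] (root k) (suc n) (root k) (suc n) ⟩
      root k * root k * (suc n * suc n)                ≤⟨ ℕ.*-monoˡ-≤ (suc n * suc n) (root-lower k) ⟩
      m * (suc k * suc k) * (suc n * suc n)            ≡⟨ solve 3 (λ m a b → m :* a :* b := m :* b :* a) ≡.refl m (suc k * suc k) (suc n * suc n) ⟩
      m * (suc n * suc n) * (suc k * suc k)            <⟨ ℕ.*-monoˡ-< (suc k * suc k) (root-upper n) ⟩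
      suc (root n) * suc (root n) * (suc k * suc k)    ≡⟨ ℕ.[m*n]*[o*p]≡[m*o]*[n*p] (suc (root n)) (suc k) (suc (root n)) (suc k) ⟨
      suc (root n) * suc k * (suc (root n) * suc k)    ∎
      where
      open ℕ.≤-Reasoning
      open +-*-Solver

    root-bound : ∀ n → root n < suc m * suc n
    root-bound n = square-cancel-< $ begin-strict
      root n * root n                           ≤⟨ root-lower n ⟩
      m * (suc n * suc n)                       <⟨ ℕ.*-monoˡ-< (suc n * suc n) (ℕ.n<1+n m) ⟩
      suc m * (suc n * suc n)                   ≤⟨ ℕ.*-monoˡ-≤ (suc n * suc n) (ℕ.m≤m*n (suc m) (suc m)) ⟩
      suc m * suc m * (suc n * suc n)           ≡⟨ ℕ.[m*n]*[o*p]≡[m*o]*[n*p] (suc m) (suc n) (suc m) (suc n) ⟨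
      suc m * suc n * (suc m * suc n)           ∎
      where
      open ℕ.≤-Reasoning

-- Square roots of natural numbers as limits.

module SquareRoot {c ℓ₁ ℓ₂} (ℝ : RealField c ℓ₁ ℓ₂) (m : ℕ) where
  open RealField ℝ
  open OrderedField ℝ
  open FloorSqrt
  open ≈-Reasoning setoid

  private
    M : Carrier
    M = fromℕ m

    U A i s : ℕ → Carrier
    U n = fromℕ (root m n)
    A n = fromℕ (suc n)
    i n = 1/1+ n
    s n = U n * i n

  cancel : ∀ n x → x * (A n * i n) ≈ x
  cancel n x = trans (*-congˡ (fromℕ-1/1+ n)) (*-identityʳ x)

  approx-cross : ∀ k n → s k < s n + i n
  approx-cross k n = <-respˡ eqˡ (<-respʳ eqʳ (*-monoʳ-< (i k * i n) (*-pos (0<1/1+ k) (0<1/1+ n))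
      (<-respˡ (fromℕ-* (root m k) (suc n)) (<-respʳ (fromℕ-* (suc (root m n)) (suc k))
        (fromℕ-mono-< (root-cross m k n))))))
    where
    eqˡ : U k * A n * (i k * i n) ≈ s k
    eqˡ = trans (solve 4 (λ u a x y → u :* a :* (x :* y) := u :* x :* (a :* y)) refl (U k) (A n) (i k) (i n))
                (cancel n (s k))
    eqʳ : (1# + U n) * A k * (i k * i n) ≈ s n + i n
    eqʳ = trans (solve 4 (λ u a x y → (con (+ 1) :+ u) :* a :* (x :* y) := (u :* y :+ y) :* (a :* x)) refl (U n) (A k) (i k) (i n))
                (cancel k (s n + i n))

  -- `root-lower` is not strict, so 1 is added on its right before dividing by (n + 1)²; this is the
  -- origin of the term `i n * i n`.
  approx-lower : ∀ n → s n * s n < M + i n * i n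
  approx-lower n = <-respˡ eqˡ (<-respʳ eqʳ (*-monoʳ-< (i n * i n) (*-pos (0<1/1+ n) (0<1/1+ n))
      (<-respˡ (fromℕ-* (root m n) (root m n)) (<-respʳ cast (fromℕ-mono-< (s≤s (root-lower m n)))))))
    where
    cast : fromℕ (suc (m ℕ.* (suc n ℕ.* suc n))) ≈ 1# + M * (A n * A n)
    cast = +-congˡ (trans (fromℕ-* m (suc n ℕ.* suc n)) (*-congˡ (fromℕ-* (suc n) (suc n))))
    eqˡ : U n * U n * (i n * i n) ≈ s n * s n
    eqˡ = solve 2 (λ u x → u :* u :* (x :* x) := u :* x :* (u :* x)) refl (U n) (i n)
    eqʳ : (1# + M * (A n * A n)) * (i n * i n) ≈ M + i n * i n
    eqʳ = begin
      (1# + M * (A n * A n)) * (i n * i n)        ≈⟨ solve 3 (λ b a x → (con (+ 1) :+ b :* (a :* a)) :* (x :* x) := b :* (a :* x) :* (a :* x) :+ x :* x) refl M (A n) (i n) ⟩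
      M * (A n * i n) * (A n * i n) + i n * i n   ≈⟨ +-congʳ (trans (cancel n _) (cancel n M)) ⟩
      M + i n * i n                               ∎

  approx-upper : ∀ n → M < (s n + i n) * (s n + i n)
  approx-upper n = <-respˡ eqˡ (<-respʳ eqʳ (*-monoʳ-< (i n * i n) (*-pos (0<1/1+ n) (0<1/1+ n))
      (<-respˡ cast (<-respʳ (fromℕ-* (suc (root m n)) (suc (root m n))) (fromℕ-mono-< (root-upper m n))))))
    where
    cast : fromℕ (m ℕ.* (suc n ℕ.* suc n)) ≈ M * (A n * A n)
    cast = trans (fromℕ-* m (suc n ℕ.* suc n)) (*-congˡ (fromℕ-* (suc n) (suc n)))
    eqˡ : M * (A n * A n) * (i n * i n) ≈ M
    eqˡ = begin
      M * (A n * A n) * (i n * i n)     ≈⟨ solve 3 (λ b a x → b :* (a :* a) :* (x :* x) := b :* (a :* x) :* (a :* x)) refl M (A n) (i n) ⟩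
      M * (A n * i n) * (A n * i n)     ≈⟨ trans (cancel n _) (cancel n M) ⟩
      M                                 ∎
    eqʳ : (1# + U n) * (1# + U n) * (i n * i n) ≈ (s n + i n) * (s n + i n)
    eqʳ = solve 2 (λ u x → (con (+ 1) :+ u) :* (con (+ 1) :+ u) :* (x :* x) := (u :* x :+ x) :* (u :* x :+ x)) refl (U n) (i n)

  approx-bound : ∀ n → s n < 1# + M
  approx-bound n = <-respʳ (trans (*-assoc _ _ _) (cancel n (1# + M)))
    (*-monoʳ-< (i n) (0<1/1+ n) (<-respʳ (fromℕ-* (suc m) (suc n)) (fromℕ-mono-< (root-bound m n))))

  -- A strict substitute for nonnegativity of `s n`, from the positivity of (root + 1)/(n + 1).
  -1/1+<approx : ∀ n → - i n < s n
  -1/1+<approx n = <-shift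
    (solve 2 (λ u x → (con (+ 1) :+ u) :* x :- con (+ 0) := u :* x :- :- x) refl (U n) (i n))
    (*-pos (0<fromℕ (suc (root m n))) (0<1/1+ n))

  -- `approx-cross` relates any two indices in either order, so it remains to make 1/(n + 1) smaller
  -- than ε.
  approx-cauchy : IsCauchy s
  approx-cauchy ε 0<ε =
    let N , small = 1/1+-small 0<ε
    in N , λ k n N≤k N≤n → <-trans (approx-cross k n)
         (<-shift (solve 3 (λ x y e → e :- y := x :+ e :- (x :+ y)) refl (s n) (i n) ε) (small n N≤n))

  module _ {l : Carrier} (s→l : s ConvergesTo l) where

    private
      -- Error constants valid for ε < 1. `2M+3` exceeds 2 `s n` + `i n`, the factor in (s + i)² -
      -- s² = (2s + i)i. `B` exceeds the absolute value of l + `s n`, which lies between -3 and 2(1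
      -- + M) + 1.
      2M+3 B : Carrier
      2M+3 = (1# + M) + (1# + M) + 1#
      B    = (1# + M) + (1# + M) + (1# + 1# + 1#)

    close : ∀ ε → 0# < ε → ∃[ n ] (i n < ε × s n < l + ε × l < s n + ε)
    close ε 0<ε =
      let N₁ , conv  = s→l ε 0<ε
          N₂ , small = 1/1+-small 0<ε
          n          = N₁ ℕ.⊔ N₂
          s<l+ε , l<s+ε = conv n (ℕ.m≤m⊔n N₁ N₂)
      in n , small n (ℕ.m≤n⊔m N₁ N₂) , s<l+ε , l<s+ε

    0<1+M : 0# < 1# + M
    0<1+M = 0<fromℕ (suc m)

    0<2M+3 : 0# < 2M+3
    0<2M+3 = +-pos (+-pos 0<1+M 0<1+M) 0<1

    0<B : 0# < B
    0<B = +-pos (+-pos 0<1+M 0<1+M) (+-pos (+-pos 0<1 0<1) 0<1)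

    -- At one index where `s n` is within ε of l and `i n` is below ε, the distance from l² to `M`
    -- is controlled through l² - x² = (l - x)(l + x) and the bounds on x² for x = `s n`.
    module Estimates {ε} (ε<1 : ε < 1#) (n : ℕ) (i<ε : i n < ε)
                     (s<l+ε : s n < l + ε) (l<s+ε : l < s n + ε) where
      private
        x = s n
        j = i n

      -ε<l-x : - ε < l - x
      -ε<l-x = <-shift (solve 3 (λ e l x → l :+ e :- x := l :- x :- :- e) refl ε l x) s<l+ε

      l-x<ε : l - x < ε
      l-x<ε = <-shift (solve 3 (λ e l x → x :+ e :- l := e :- (l :- x)) refl ε l x) l<s+ε

      -ε<x-l : - ε < x - l
      -ε<x-l = <-shift (solve 3 (λ e l x → x :+ e :- l := x :- l :- :- e) refl ε l x) l<s+ε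

      x-l<ε : x - l < ε
      x-l<ε = <-shift (solve 3 (λ e l x → l :+ e :- x := e :- (x :- l)) refl ε l x) s<l+ε

      -1<x : - 1# < x
      -1<x = <-trans (<-shift (solve 1 (λ j → con (+ 1) :- j := :- j :- :- con (+ 1)) refl j) (<-trans i<ε ε<1)) (-1/1+<approx n)

      l+x<B : l + x < B
      l+x<B = <-shift
        (solve 4 (λ e l x b → ((x :+ e) :+ con (+ 1) :+ (b :+ b) :+ con (+ 2)) :- (l :+ e :+ (x :+ x) :+ con (+ 0))
                 := (b :+ b :+ con (+ 3)) :- (l :+ x)) refl ε l x (1# + M))
        (+-mono-< (+-mono-< (+-mono-< l<s+ε ε<1) (+-mono-< (approx-bound n) (approx-bound n))) (+-pos 0<1 0<1))

      -B<l+x : - B < l + x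
      -B<l+x = <-shift
        (solve 4 (λ e l x b → (((l :+ e) :+ con (+ 1)) :+ (x :+ x) :+ (b :+ b)) :- (((x :+ e) :+ (:- con (+ 1) :+ :- con (+ 1))) :+ con (+ 0))
                 := (l :+ x) :- :- (b :+ b :+ con (+ 3))) refl ε l x (1# + M))
        (+-mono-< (+-mono-< (+-mono-< s<l+ε ε<1) (+-mono-< -1<x -1<x)) (+-pos 0<1+M 0<1+M))

      l²-x²-bound : (l - x) * (l + x) + (l - x) * (l + x) < ε * B + ε * B
      l²-x²-bound = *-bound -ε<l-x l-x<ε -B<l+x l+x<B

      x²-l²-bound : (x - l) * (l + x) + (x - l) * (l + x) < ε * B + ε * B
      x²-l²-bound = *-bound -ε<x-l x-l<ε -B<l+x l+x<B

      x²<M+ε : x * x < M + ε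
      x²<M+ε = <-trans (approx-lower n) (<-shift
        (solve 3 (λ b j e → con (+ 1) :* e :- j :* j := (b :+ e) :- (b :+ j :* j)) refl M j ε)
        (<-trans (*-monoʳ-< j (0<1/1+ n) (<-trans i<ε ε<1))
          (<-shift (solve 2 (λ j e → e :- j := con (+ 1) :* e :- con (+ 1) :* j) refl j ε) i<ε)))

      M<x²+2M+3ε : M < x * x + ε * 2M+3
      M<x²+2M+3ε = <-trans (approx-upper n) (<-shift
        (solve 4 (λ c j x e → (e :* c) :- (x :+ x :+ j) :* j := (x :* x :+ e :* c) :- ((x :+ j) :* (x :+ j))) refl 2M+3 j x ε)
        (<-trans (*-monoʳ-< j (0<1/1+ n) (+-mono-< (+-mono-< (approx-bound n) (approx-bound n)) (<-trans i<ε ε<1)))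
          (<-respˡ (*-comm j 2M+3) (*-monoʳ-< 2M+3 0<2M+3 i<ε))))

      2l²< : l * l + l * l < M + M + (1# + 1# + (B + B)) * ε
      2l²< = <-shift
        (solve 5 (λ l x b m e → ((e :* b :+ e :* b) :+ (m :+ e :+ (m :+ e))) :- (((l :- x) :* (l :+ x) :+ (l :- x) :* (l :+ x)) :+ (x :* x :+ x :* x))
                 := (m :+ m :+ (con (+ 2) :+ (b :+ b)) :* e) :- (l :* l :+ l :* l)) refl l x B M ε)
        (+-mono-< l²-x²-bound (+-mono-< x²<M+ε x²<M+ε))

      2M< : M + M < l * l + l * l + (2M+3 + 2M+3 + (B + B)) * ε
      2M< = <-shift
        (solve 6 (λ l x b m e c → ((e :* b :+ e :* b) :+ (x :* x :+ e :* c :+ (x :* x :+ e :* c))) :- (((x :- l) :* (l :+ x) :+ (x :- l) :* (l :+ x)) :+ (m :+ m))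
                 := (l :* l :+ l :* l :+ (c :+ c :+ (b :+ b)) :* e) :- (m :+ m)) refl l x B M ε 2M+3)
        (+-mono-< x²-l²-bound (+-mono-< M<x²+2M+3ε M<x²+2M+3ε))

    -- Each strict inequality is refuted by `<-margin⇒≮`, because the opposite estimate holds up to
    -- a fixed multiple of every ε below 1.
    2l²≈2M : l * l + l * l ≈ M + M
    2l²≈2M = ≮≯⇒≈
      (<-margin⇒≮ (+-pos (+-pos 0<2M+3 0<2M+3) (+-pos 0<B 0<B)) λ ε 0<ε ε<1 →
        let n , i<ε , s<l+ε , l<s+ε = close ε 0<ε in Estimates.2M< ε<1 n i<ε s<l+ε l<s+ε)
      (<-margin⇒≮ (+-pos (+-pos 0<1 0<1) (+-pos 0<B 0<B)) λ ε 0<ε ε<1 →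
        let n , i<ε , s<l+ε , l<s+ε = close ε 0<ε in Estimates.2l²< ε<1 n i<ε s<l+ε l<s+ε)

  sqrt-fromℕ : ∃[ l ] l * l ≈ fromℕ m
  sqrt-fromℕ =
    let l , s→l = complete s approx-cauchy
    in l , double-injective (2l²≈2M s→l)

-- Counting matches in a list, and adjacency numbers of a hypergraph.

module _ {a p} {A : Set a} {P : Pred A p} (P? : Decidable P) where

  length-filter-none : ∀ {xs} → (∀ {y} → y List.∈ xs → ¬ P y) → length (filter P? xs) ≡ 0
  length-filter-none ¬P = ≡.cong length (filter-none P? (All.tabulate ¬P))

  length-filter-one : ∀ {x xs} → Unique xs → x List.∈ xs → P x →
                      (∀ {y} → y List.∈ xs → P y → y ≡ x) → length (filter P? xs) ≡ 1
  length-filter-one {xs = x ∷ xs} (x∉xs ∷ _) (here ≡.refl) Px only-x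
    rewrite filter-accept P? {xs = xs} Px =
    ≡.cong suc (length-filter-none λ y∈xs Py →
      All.lookup x∉xs y∈xs (≡.sym (only-x (there y∈xs) Py)))
  length-filter-one {xs = y ∷ xs} (y∉xs ∷ xs!) (there x∈xs) Px only-x
    rewrite filter-reject P? {xs = xs} (λ Py → All.lookup y∉xs x∈xs (only-x (here ≡.refl) Py)) =
    length-filter-one xs! x∈xs Px (only-x ∘ there)

pair⊆⁺ : ∀ {n} {i j : Fin n} {e : Subset n} → i ∈ e → j ∈ e → ⁅ i ⁆ ∪ ⁅ j ⁆ ⊆ e
pair⊆⁺ {i = i} {j} i∈e j∈e x∈ with x∈p∪q⁻ ⁅ i ⁆ ⁅ j ⁆ x∈
... | inj₁ x∈i rewrite x∈⁅y⁆⇒x≡y i x∈i = i∈e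
... | inj₂ x∈j rewrite x∈⁅y⁆⇒x≡y j x∈j = j∈e

pair⊆⁻ˡ : ∀ {n} (i j : Fin n) {e : Subset n} → ⁅ i ⁆ ∪ ⁅ j ⁆ ⊆ e → i ∈ e
pair⊆⁻ˡ i j ⊆e = ⊆e (x∈p∪q⁺ (inj₁ (x∈⁅x⁆ i)))

pair⊆⁻ʳ : ∀ {n} (i j : Fin n) {e : Subset n} → ⁅ i ⁆ ∪ ⁅ j ⁆ ⊆ e → j ∈ e
pair⊆⁻ʳ i j ⊆e = ⊆e (x∈p∪q⁺ (inj₂ (x∈⁅x⁆ j)))

module _ (G : Hypergraph) {i j : Fin (order G)} where

  adjacency-diagonal : i ≡ j → adjacency G i j ≡ 0
  adjacency-diagonal i≡j with i ≟ j
  ... | yes _   = ≡.refl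
  ... | no  i≢j = contradiction i≡j i≢j

  adjacency-none : (∀ {e} → e List.∈ edges G → i ∈ e → ¬ (j ∈ e)) → adjacency G i j ≡ 0
  adjacency-none none with i ≟ j
  ... | yes _ = ≡.refl
  ... | no  _ = length-filter-none (_ ⊆?_) λ e∈G ij⊆e → none e∈G (pair⊆⁻ˡ i j ij⊆e) (pair⊆⁻ʳ i j ij⊆e)

  adjacency-one : ∀ {e} → i ≢ j → e List.∈ edges G → i ∈ e → j ∈ e →
                  (∀ {f} → f List.∈ edges G → i ∈ f → j ∈ f → f ≡ e) → adjacency G i j ≡ 1
  adjacency-one i≢j e∈G i∈e j∈e only-e with i ≟ j
  ... | yes i≡j = contradiction i≡j i≢j
  ... | no  _   = length-filter-one (_ ⊆?_) (unique G) e∈G (pair⊆⁺ i∈e j∈e)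
                    λ f∈G ij⊆f → only-e f∈G (pair⊆⁻ˡ i j ij⊆f) (pair⊆⁻ʳ i j ij⊆f)

-- Adjacency numbers of the hyperstar.

module HyperstarAdjacency (p q : ℕ) (2≤1+q : 2 ℕ.≤ suc q) where

  private
    G : Hypergraph
    G = hyperstar (suc p) (suc q) 2≤1+q

    -- The branch containing a leaf: vertex `suc y` is `leaf i j` for the pair `remQuot q y` = (i,
    -- j).
    β : Fin (p ℕ.* q) → Fin p
    β = quotient q

  branch∈edges : ∀ i → branch {p} {q} i List.∈ edges G
  branch∈edges i = ∈-map⁺ (branch {p} {q}) (∈-allFin i)

  centre∈branch : ∀ i → zero ∈ branch {p} {q} i
  centre∈branch i = x∈p∪q⁺ (inj₁ (x∈⁅x⁆ zero))

  ∈branch⁺ : ∀ y → suc y ∈ branch (β y)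
  ∈branch⁺ y = ≡.subst (λ z → suc z ∈ branch (β y)) (combine-remQuot {p} q y)
                 (leaf∈branch (β y) (proj₂ (remQuot {p} q y)))

  ∈branch⁻ : ∀ y {i} → suc y ∈ branch i → β y ≡ i
  ∈branch⁻ y {i} y∈ = leaf∈branch⁻ (β y) i (proj₂ (remQuot {p} q y))
    (≡.subst (λ z → suc z ∈ branch i) (≡.sym (combine-remQuot {p} q y)) y∈)

  -- The key to all adjacency numbers: since a leaf lies in a single hyperedge, a pair containing a
  -- leaf is covered at most once.
  only-branch : ∀ y {e} → e List.∈ edges G → suc y ∈ e → e ≡ branch (β y)
  only-branch y e∈G y∈e with i , _ , ≡.refl ← ∈-map⁻ branch e∈G = ≡.cong branch (≡.sym (∈branch⁻ y y∈e))

  adjacency-centre-leaf : ∀ y → adjacency G zero (suc y) ≡ 1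
  adjacency-centre-leaf y = adjacency-one G (λ ()) (branch∈edges (β y)) (centre∈branch (β y)) (∈branch⁺ y)
    λ e∈G _ y∈e → only-branch y e∈G y∈e

  adjacency-leaf-centre : ∀ y → adjacency G (suc y) zero ≡ 1
  adjacency-leaf-centre y = adjacency-one G (λ ()) (branch∈edges (β y)) (∈branch⁺ y) (centre∈branch (β y))
    λ e∈G y∈e _ → only-branch y e∈G y∈e

  adjacency-same-branch : ∀ {x y} → x ≢ y → β x ≡ β y → adjacency G (suc x) (suc y) ≡ 1
  adjacency-same-branch {x} {y} x≢y βx≡βy =
    adjacency-one G (x≢y ∘ suc-injective) (branch∈edges (β x)) (∈branch⁺ x)
      (≡.subst (λ i → suc y ∈ branch i) (≡.sym βx≡βy) (∈branch⁺ y))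
      λ e∈G x∈e _ → only-branch x e∈G x∈e

  adjacency-other-branch : ∀ {x y} → β x ≢ β y → adjacency G (suc x) (suc y) ≡ 0
  adjacency-other-branch {x} {y} βx≢βy = adjacency-none G λ e∈G x∈e y∈e →
    βx≢βy (≡.sym (∈branch⁻ y (≡.subst (suc y ∈_) (only-branch x e∈G x∈e) y∈e)))

-- The Seidel matrix of the hyperstar and its main eigenvalues.

module HyperstarSeidel {c ℓ₁ ℓ₂} (ℝ : RealField c ℓ₁ ℓ₂) (p q : ℕ) (2≤1+q : 2 ℕ.≤ suc q) where
  open RealField ℝ hiding (zero)
  open CommutativeRing commutativeRing using (semiring)
  open SemiringSum semiring using
    ( sum-cong-≋; sum-replicate; sum-replicate-zero; ∑-distrib-+; ∑-comm
    ; *-distribˡ-sum; *-distribʳ-sum )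
  open OrderedField ℝ
  open Spectral ℝ
  open HyperstarAdjacency p q 2≤1+q
  open ≈-Reasoning setoid

  private
    G : Hypergraph
    G = hyperstar (suc p) (suc q) 2≤1+q

    S : Matrix (order G)
    S = seidel G

    β : Fin (p ℕ.* q) → Fin p
    β = quotient q

  -- The block diagonal matrix given by the Kronecker product of the identity of order p with the
  -- all-ones matrix of order q.
  sameBranch : Matrix (p ℕ.* q)
  sameBranch x y = I p (β x) (β y)

  S-centre-centre : S zero zero ≈ 0#
  S-centre-centre = solve 1 (λ t → con (+ 1) :- con (+ 1) :- t :* con (+ 0) := con (+ 0)) refl (fromℕ 2)

  adjacent-entry : ∀ {m} → m ≡ 1 → 1# - 0# - fromℕ 2 * fromℕ m ≈ - 1#
  -- `fromℕ` uses plain multiples, so 2 and 1 appear as `1# + (1# + 0#)` and `1# + 0#` and are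
  -- spelled out accordingly.
  adjacent-entry ≡.refl = solve 0 (con (+ 1) :- con (+ 0) :- (con (+ 1) :+ (con (+ 1) :+ con (+ 0))) :* (con (+ 1) :+ con (+ 0)) := :- con (+ 1)) refl

  S-centre-leaf : ∀ y → S zero (suc y) ≈ - 1#
  S-centre-leaf y = adjacent-entry (adjacency-centre-leaf y)

  S-leaf-centre : ∀ y → S (suc y) zero ≈ - 1#
  S-leaf-centre y = adjacent-entry (adjacency-leaf-centre y)

  -- The matrix J + I - 2 `sameBranch`: its entries are 1 + 1 - 2 = 0 on the diagonal, -1 within a
  -- branch and 1 between branches.
  leafBlock : Matrix (p ℕ.* q)
  leafBlock x y = 1# + I _ x y + (- 1# - 1#) * sameBranch x y

  S-leaf-leaf : ∀ x y → S (suc x) (suc y) ≈ leafBlock x y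
  -- With both decisions passed as arguments, matching on them reduces the identity entries on the
  -- two sides together.
  S-leaf-leaf x y = entry (x ≟ y) (β x ≟ β y)
    where
    seidelEntry : Carrier → ℕ → Carrier
    seidelEntry δ m = 1# - δ - fromℕ 2 * fromℕ m

    entry : (δ? : Dec (x ≡ y)) (σ? : Dec (β x ≡ β y)) →
            seidelEntry (if does δ? then 1# else 0#) (adjacency G (suc x) (suc y)) ≈
            1# + (if does δ? then 1# else 0#) + (- 1# - 1#) * (if does σ? then 1# else 0#)
    entry (yes x≡y) (no βx≢βy)  = contradiction (≡.cong β x≡y) βx≢βy
    entry (yes x≡y) (yes _)     = trans (reflexive (≡.cong (seidelEntry 1#) (adjacency-diagonal G (≡.cong suc x≡y))))
      (solve 1 (λ t → con (+ 1) :- con (+ 1) :- t :* con (+ 0)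
                := con (+ 1) :+ con (+ 1) :+ (:- con (+ 1) :- con (+ 1)) :* con (+ 1)) refl (fromℕ 2))
    entry (no x≢y)  (yes βx≡βy) = trans (adjacent-entry (adjacency-same-branch x≢y βx≡βy))
      (solve 0 (:- con (+ 1) := con (+ 1) :+ con (+ 0) :+ (:- con (+ 1) :- con (+ 1)) :* con (+ 1)) refl)
    entry (no x≢y)  (no βx≢βy)  = trans (reflexive (≡.cong (seidelEntry 0#) (adjacency-other-branch βx≢βy)))
      (solve 1 (λ t → con (+ 1) :- con (+ 0) :- t :* con (+ 0)
                := con (+ 1) :+ con (+ 0) :+ (:- con (+ 1) :- con (+ 1)) :* con (+ 0)) refl (fromℕ 2))

  I-sym : ∀ {n} i j → I n i j ≡ I n j i
  I-sym i j = ≡.cong (if_then 1# else 0#) (does-⇔ (mk⇔ ≡.sym ≡.sym) (i ≟ j) (j ≟ i))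

  leafBlock-sym : ∀ x y → leafBlock x y ≡ leafBlock y x
  leafBlock-sym x y = ≡.cong₂ (λ δ σ → 1# + δ + (- 1# - 1#) * σ) (I-sym x y) (I-sym (β x) (β y))

  sum-one : ∀ n → sum {n} (λ _ → 1#) ≈ fromℕ n
  sum-one n = sum-replicate n

  sum-I : ∀ {n} (i : Fin n) → sum (I n i) ≈ 1#
  sum-I {suc n} zero    = trans (+-congˡ (sum-replicate-zero n)) (+-identityʳ 1#)
  sum-I {suc n} (suc i) = trans (+-identityˡ _) (sum-I i)

  sum-++ : ∀ m {n} (f : Vector Carrier (m ℕ.+ n)) →
           sum f ≈ sum (f ∘ (_↑ˡ n)) + sum (f ∘ (m ↑ʳ_))
  sum-++ zero    f = sym (+-identityˡ _)
  sum-++ (suc m) f = trans (+-congˡ (sum-++ m (f ∘ suc))) (sym (+-assoc _ _ _))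

  sum-combine : ∀ m {n} (f : Vector Carrier (m ℕ.* n)) →
                sum f ≈ sum {m} (λ i → sum {n} (λ j → f (combine i j)))
  sum-combine zero        f = refl
  sum-combine (suc m) {n} f = trans (sum-++ n f) (+-congˡ (sum-combine m (f ∘ (n ↑ʳ_))))

  -- Arranged by branches, the double sum factors into a row sum of the identity, which is 1, and
  -- the branch size q.
  sum-sameBranch : ∀ x → sum (sameBranch x) ≈ fromℕ q
  sum-sameBranch x = begin
    sum (sameBranch x)                                        ≈⟨ sum-combine p (sameBranch x) ⟩
    sum (λ i → sum {q} (λ j → I p (β x) (β (combine {p} i j))))   ≈⟨ sum-cong-≋ (λ i → sum-cong-≋ (λ j → entry i j)) ⟩
    sum (λ i → sum {q} (λ _ → I p (β x) i * 1#))              ≈⟨ sum-cong-≋ (λ i → *-distribˡ-sum {q} (I p (β x) i) (λ _ → 1#)) ⟨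
    sum (λ i → I p (β x) i * sum {q} (λ _ → 1#))              ≈⟨ *-distribʳ-sum (sum {q} (λ _ → 1#)) (I p (β x)) ⟨
    sum (I p (β x)) * sum {q} (λ _ → 1#)                      ≈⟨ *-cong (sum-I (β x)) (sum-one q) ⟩
    1# * fromℕ q                                              ≈⟨ *-identityˡ _ ⟩
    fromℕ q                                                   ∎
    where
    entry : ∀ i j → I p (β x) (β (combine {p} i j)) ≈ I p (β x) i * 1#
    entry i j = trans (reflexive (≡.cong (I p (β x) ∘ proj₁) (remQuot-combine i j))) (sym (*-identityʳ _))

  -- Written as pq + 1 - 2q with subtraction in the field, so that it makes sense for every p.
  a b : Carrier
  a = fromℕ (p ℕ.* q) + 1# + (- 1# - 1#) * fromℕ q
  b = fromℕ (p ℕ.* q)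

  leafBlock-row-sum : ∀ x → sum (leafBlock x) ≈ a
  leafBlock-row-sum x = begin
    sum (leafBlock x)
      ≈⟨ ∑-distrib-+ (λ y → 1# + I _ x y) (λ y → (- 1# - 1#) * sameBranch x y) ⟩
    sum (λ y → 1# + I _ x y) + sum (λ y → (- 1# - 1#) * sameBranch x y)
      ≈⟨ +-cong (∑-distrib-+ (λ _ → 1#) (I _ x)) (sym (*-distribˡ-sum (- 1# - 1#) (sameBranch x))) ⟩
    sum {p ℕ.* q} (λ _ → 1#) + sum (I _ x) + (- 1# - 1#) * sum (sameBranch x)
      ≈⟨ +-cong (+-cong (sum-one (p ℕ.* q)) (sum-I x)) (*-congˡ (sum-sameBranch x)) ⟩
    a ∎

  leafBlock-column-sum : ∀ y → sum (λ x → leafBlock x y) ≈ a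
  leafBlock-column-sum y = trans (sum-cong-≋ (λ x → reflexive (leafBlock-sym x y))) (leafBlock-row-sum y)

  S-centre-row : ∀ (v : Vector Carrier (order G)) → sum (λ j → S zero j * v j) ≈ - sum (v ∘ suc)
  S-centre-row v = begin
    S zero zero * v zero + sum (λ y → S zero (suc y) * v (suc y))
      ≈⟨ +-cong (*-congʳ S-centre-centre) (sum-cong-≋ λ y → *-congʳ (S-centre-leaf y)) ⟩
    0# * v zero + sum (λ y → - 1# * v (suc y))
      ≈⟨ +-congˡ (*-distribˡ-sum (- 1#) (v ∘ suc)) ⟨
    0# * v zero + - 1# * sum (v ∘ suc)
      ≈⟨ solve 2 (λ x t → con (+ 0) :* x :+ :- con (+ 1) :* t := :- t) refl (v zero) (sum (v ∘ suc)) ⟩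
    - sum (v ∘ suc) ∎

  -- The factor `1#` is kept so that the sum over all leaf rows can be taken out of the first term
  -- as a sum of ones.
  S-leaf-row : ∀ (v : Vector Carrier (order G)) x →
               sum (λ j → S (suc x) j * v j) ≈ 1# * - v zero + sum (λ y → leafBlock x y * v (suc y))
  S-leaf-row v x = +-cong
    (trans (*-congʳ (S-leaf-centre x)) (solve 1 (λ c → :- con (+ 1) :* c := con (+ 1) :* :- c) refl (v zero)))
    (sum-cong-≋ λ y → *-congʳ (S-leaf-leaf x y))

  -- Summing the leaf rows uses only the column sums of leafBlock, so no
  -- decomposition of v by branches is needed.
  S-leaf-rows-sum : ∀ (v : Vector Carrier (order G)) →
                    sum (λ x → sum (λ j → S (suc x) j * v j)) ≈ b * - v zero + a * sum (v ∘ suc)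
  S-leaf-rows-sum v = begin
    sum (λ x → sum (λ j → S (suc x) j * v j))
      ≈⟨ sum-cong-≋ (S-leaf-row v) ⟩
    sum (λ x → 1# * - v zero + sum (λ y → leafBlock x y * v (suc y)))
      ≈⟨ ∑-distrib-+ (λ _ → 1# * - v zero) (λ x → sum (λ y → leafBlock x y * v (suc y))) ⟩
    sum {p ℕ.* q} (λ _ → 1# * - v zero) + sum (λ x → sum (λ y → leafBlock x y * v (suc y)))
      ≈⟨ +-cong (trans (sym (*-distribʳ-sum {p ℕ.* q} (- v zero) (λ _ → 1#))) (*-congʳ (sum-one (p ℕ.* q))))
                (∑-comm (λ x y → leafBlock x y * v (suc y))) ⟩
    b * - v zero + sum (λ y → sum (λ x → leafBlock x y * v (suc y)))
      ≈⟨ +-congˡ (sum-cong-≋ λ y → trans (sym (*-distribʳ-sum (v (suc y)) (λ x → leafBlock x y))) (*-congʳ (leafBlock-column-sum y))) ⟩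
    b * - v zero + sum (λ y → a * v (suc y))
      ≈⟨ +-congˡ (*-distribˡ-sum a (v ∘ suc)) ⟨
    b * - v zero + a * sum (v ∘ suc) ∎

  -- The entry sum x + T is apart from zero and can be cancelled, so it suffices that its product
  -- with the polynomial vanishes.
  main⇒root : ∀ {λ′} → IsMainSeidelEigenvalue G λ′ → λ′ * λ′ - a * λ′ - b ≈ 0#
  main⇒root {t} (v , (_ , Sv≈tv) , Σv#0) = x#0∧x*y≈0⇒y≈0 Σv#0 (begin
    (x + T) * (t * t - a * t - b)
      ≈⟨ solve 5 (λ x T t a b → (x :+ T) :* (t :* t :- a :* t :- b)
                    := t :* (t :* x) :+ t :* (t :* T) :- a :* (t :* x) :- a :* (t :* T) :- b :* (x :+ T)) refl x T t a b ⟩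
    t * (t * x) + t * (t * T) - a * (t * x) - a * (t * T) - b * (x + T)
      ≈⟨ +-congʳ (+-congʳ (+-cong (+-cong (*-congˡ tx) (*-congˡ tT)) (-‿cong (*-congˡ tx)))) ⟩
    t * (- T) + t * (b * - x + a * T) - a * (- T) - a * (t * T) - b * (x + T)
      ≈⟨ solve 5 (λ x T t a b → t :* (:- T) :+ t :* (b :* :- x :+ a :* T) :- a :* (:- T) :- a :* (t :* T) :- b :* (x :+ T)
                    := :- (t :* T) :- b :* (t :* x) :+ a :* T :- b :* (x :+ T)) refl x T t a b ⟩
    - (t * T) - b * (t * x) + a * T - b * (x + T)
      -- The first substitution leaves t only in the products tT and tx; applying the two row
      -- equations again removes it altogether.
      ≈⟨ +-congʳ (+-congʳ (+-cong (-‿cong tT) (-‿cong (*-congˡ tx)))) ⟩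
    - (b * - x + a * T) - b * (- T) + a * T - b * (x + T)
      ≈⟨ solve 4 (λ x T a b → :- (b :* :- x :+ a :* T) :- b :* (:- T) :+ a :* T :- b :* (x :+ T) := con (+ 0)) refl x T a b ⟩
    0# ∎)
    where
    x T : Carrier
    x = v zero
    T = sum (v ∘ suc)
    tx : t * x ≈ - T
    tx = trans (sym (Sv≈tv zero)) (S-centre-row v)
    tT : t * T ≈ b * - x + a * T
    tT = begin
      t * T                                         ≈⟨ *-distribˡ-sum t (v ∘ suc) ⟩
      sum (λ y → t * v (suc y))                     ≈⟨ sum-cong-≋ (λ y → Sv≈tv (suc y)) ⟨
      sum (λ x → sum (λ j → S (suc x) j * v j))     ≈⟨ S-leaf-rows-sum v ⟩
      b * - x + a * T                               ∎

  root⇒main : ∀ {λ′} → Fin (p ℕ.* q) → a + b - λ′ # 0# → λ′ * λ′ - a * λ′ - b ≈ 0# →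
              IsMainSeidelEigenvalue G λ′
  root⇒main {t} y₀ a+b-t#0 root = v , ((suc y₀ , 1#0) , eigen) , #-congʳ (sym Σv) a+b-t#0
    where
    v : Vector Carrier (order G)
    -- Forced by the leaf rows: with leaf entries 1 and centre entry x they read -x + a = t. The
    -- centre row then amounts to the quadratic equation.
    v zero    = a - t
    v (suc _) = 1#
    Σv : sum v ≈ a + b - t
    Σv = trans (+-congˡ (sum-one (p ℕ.* q))) (solve 3 (λ a b t → a :- t :+ b := a :+ b :- t) refl a b t)
    eigen : ∀ i → sum (λ j → S i j * v j) ≈ t * v i
    eigen zero = begin
      sum (λ j → S zero j * v j)       ≈⟨ S-centre-row v ⟩
      - sum {p ℕ.* q} (λ _ → 1#)       ≈⟨ -‿cong (sum-one (p ℕ.* q)) ⟩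
      - b                              ≈⟨ solve 3 (λ t a b → :- b := t :* (a :- t) :+ (t :* t :- a :* t :- b)) refl t a b ⟩
      t * (a - t) + (t * t - a * t - b) ≈⟨ +-congˡ root ⟩
      t * (a - t) + 0#                 ≈⟨ +-identityʳ _ ⟩
      t * (a - t)                      ∎
    eigen (suc x) = begin
      sum (λ j → S (suc x) j * v j)                       ≈⟨ S-leaf-row v x ⟩
      1# * - (a - t) + sum (λ y → leafBlock x y * 1#)     ≈⟨ +-congˡ (sum-cong-≋ λ y → *-identityʳ (leafBlock x y)) ⟩
      1# * - (a - t) + sum (leafBlock x)                  ≈⟨ +-congˡ (leafBlock-row-sum x) ⟩
      1# * - (a - t) + a                                  ≈⟨ solve 2 (λ t a → con (+ 1) :* :- (a :- t) :+ a := t :* con (+ 1)) refl t a ⟩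
      t * 1#                                              ∎

-- Roots of a quadratic with a given square root of its discriminant.

module Quadratic {c ℓ₁ ℓ₂} (ℝ : RealField c ℓ₁ ℓ₂) where
  open RealField ℝ
  open OrderedField ℝ
  open ≈-Reasoning setoid

  -- Since r₁ # r₂, every x is apart from one of them, so that a vanishing
  -- product (x - r₁)(x - r₂) determines which factor is zero.
  zero-product : ∀ {r₁ r₂ x} → r₁ # r₂ → (x - r₁) * (x - r₂) ≈ 0# → x ≈ r₁ ⊎ x ≈ r₂
  zero-product {r₁} {r₂} {x} r₁#r₂ eq = Sum.swap (Sum.map
    (λ r₁#x → x-y≈0⇒x≈y (x#0∧x*y≈0⇒y≈0 (x#y⇒x-y#0 (#-sym r₁#x)) eq))
    (λ x#r₂ → x-y≈0⇒x≈y (x#0∧x*y≈0⇒y≈0 (x#y⇒x-y#0 x#r₂) (trans (*-comm _ _) eq)))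
    (#-cotrans r₁#r₂ x))
    where
    x-y≈0⇒x≈y : ∀ {x y} → x - y ≈ 0# → x ≈ y
    x-y≈0⇒x≈y {x} {y} e = begin
      x           ≈⟨ solve 2 (λ x y → x := x :- y :+ y) refl x y ⟩
      x - y + y   ≈⟨ +-congʳ e ⟩
      0# + y      ≈⟨ +-identityˡ y ⟩
      y           ∎
    x#y⇒x-y#0 : ∀ {x y} → x # y → x - y # 0#
    x#y⇒x-y#0 x#y = inverse⇒#0 _ (proj₂ (proj₂ (#⇒invertible x#y)))

  -- The roots are (a + l)/2 and (a - l)/2. They are apart because their difference is l, which is
  -- invertible.
  quadratic-roots : ∀ a b l → l # 0# → l * l ≈ a * a + (b + b + (b + b)) →
    ∃[ r₁ ] ∃[ r₂ ] (r₁ # r₂ × (∀ x → (x * x - a * x - b ≈ 0#) ⇔ (x ≈ r₁ ⊎ x ≈ r₂)))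
  quadratic-roots a b l l#0 l²≈D =
    -- One half is passed on as a variable `h`, so the solver treats it as an atom and 2h = 1 is
    -- applied by hand.
    let h , 2h≈1 = half in roots h 2h≈1
    where
    roots : ∀ h → (1# + 1#) * h ≈ 1# →
            ∃[ r₁ ] ∃[ r₂ ] (r₁ # r₂ × (∀ x → (x * x - a * x - b ≈ 0#) ⇔ (x ≈ r₁ ⊎ x ≈ r₂)))
    roots h 2h≈1 = r₁ , r₂ , r₁#r₂ , λ x → mk⇔
      (λ P≈0 → zero-product r₁#r₂ (trans (factor x) P≈0))
      (λ x≈r → trans (sym (factor x)) ([ vanish₁ x , vanish₂ x ]′ x≈r))
      where
      r₁ r₂ : Carrier
      r₁ = (a + l) * h
      r₂ = (a - l) * h
      r₁#r₂ : r₁ # r₂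
      r₁#r₂ = let k , lk≈1 = #0⇒inverse l#0 in invertible⇒# (k , trans (*-comm _ _) (inv k lk≈1) , inv k lk≈1)
        where
        inv : ∀ k → l * k ≈ 1# → (r₁ - r₂) * k ≈ 1#
        inv k lk≈1 = begin
          (r₁ - r₂) * k                ≈⟨ solve 4 (λ a l h k → ((a :+ l) :* h :- (a :- l) :* h) :* k := con (+ 2) :* h :* (l :* k)) refl a l h k ⟩
          (1# + 1#) * h * (l * k)      ≈⟨ *-cong 2h≈1 lk≈1 ⟩
          1# * 1#                      ≈⟨ *-identityˡ 1# ⟩
          1#                           ∎
      factor : ∀ x → (x - r₁) * (x - r₂) ≈ x * x - a * x - b
      factor x = begin
        (x - r₁) * (x - r₂)
          ≈⟨ solve 4 (λ x a l h → (x :- (a :+ l) :* h) :* (x :- (a :- l) :* h)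
                := x :* x :- a :* (con (+ 2) :* h) :* x :+ (a :* a :- l :* l) :* (h :* h)) refl x a l h ⟩
        x * x - a * ((1# + 1#) * h) * x + (a * a - l * l) * (h * h)
          ≈⟨ +-cong (+-congˡ (-‿cong (*-congʳ (trans (*-congˡ 2h≈1) (*-identityʳ a))))) (*-congʳ (+-congˡ (-‿cong l²≈D))) ⟩
        x * x - a * x + (a * a - (a * a + (b + b + (b + b)))) * (h * h)
          ≈⟨ solve 4 (λ x a b h → x :* x :- a :* x :+ (a :* a :- (a :* a :+ (b :+ b :+ (b :+ b)))) :* (h :* h)
                := x :* x :- a :* x :- b :* ((con (+ 2) :* h) :* (con (+ 2) :* h))) refl x a b h ⟩
        x * x - a * x - b * ((1# + 1#) * h * ((1# + 1#) * h))
          ≈⟨ +-congˡ (-‿cong (trans (*-congˡ (trans (*-cong 2h≈1 2h≈1) (*-identityˡ 1#))) (*-identityʳ b))) ⟩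
        x * x - a * x - b ∎
      vanish₁ : ∀ x → x ≈ r₁ → (x - r₁) * (x - r₂) ≈ 0#
      vanish₁ x x≈r₁ = trans (*-congʳ (trans (+-congʳ x≈r₁) (-‿inverseʳ r₁))) (zeroˡ _)
      vanish₂ : ∀ x → x ≈ r₂ → (x - r₁) * (x - r₂) ≈ 0#
      vanish₂ x x≈r₂ = trans (*-congˡ (trans (+-congʳ x≈r₂) (-‿inverseʳ r₂))) (zeroʳ _)

-- The two main eigenvalues for n = p′ + 3 and k = q′ + 2.

module HyperstarSpectrum {c ℓ₁ ℓ₂} (ℝ : RealField c ℓ₁ ℓ₂) (p′ q′ : ℕ) (2≤k : 2 ≤ suc (suc q′)) where
  open RealField ℝ hiding (zero)
  open OrderedField ℝ
  open Quadratic ℝ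
  open ≈-Reasoning setoid

  private
    p q : ℕ
    p = suc (suc p′)
    q = suc q′

  open HyperstarSeidel ℝ p q 2≤k

  private
    -- `P` stands for p - 2, while `Q` stands for q itself.
    P Q : Carrier
    P = fromℕ p′
    Q = fromℕ q

  b≈ : b ≈ (1# + (1# + P)) * Q
  b≈ = fromℕ-* p q

  a≈ : a ≈ 1# + P * Q
  a≈ = trans (+-congʳ (+-congʳ b≈))
    (solve 2 (λ P Q → (con (+ 1) :+ (con (+ 1) :+ P)) :* Q :+ con (+ 1) :+ (:- con (+ 1) :- con (+ 1)) :* Q := con (+ 1) :+ P :* Q) refl P Q)

  -- As p is at least 2, the coefficient `a` is a positive natural number. The discriminant is
  -- therefore natural, as `sqrt-fromℕ` requires, and visibly a successor.
  aℕ bℕ : ℕ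
  aℕ = suc (p′ ℕ.* q)
  bℕ = p ℕ.* q

  fromℕ-aℕ : fromℕ aℕ ≈ a
  fromℕ-aℕ = trans (+-congˡ (fromℕ-* p′ q)) (sym a≈)

  discriminant : ℕ
  discriminant = aℕ ℕ.* aℕ ℕ.+ (bℕ ℕ.+ bℕ ℕ.+ (bℕ ℕ.+ bℕ))

  fromℕ-discriminant : fromℕ discriminant ≈ a * a + (b + b + (b + b))
  fromℕ-discriminant = trans (fromℕ-+ (aℕ ℕ.* aℕ) (bℕ ℕ.+ bℕ ℕ.+ (bℕ ℕ.+ bℕ)))
    (+-cong (trans (fromℕ-* aℕ aℕ) (*-cong fromℕ-aℕ fromℕ-aℕ))
            (trans (fromℕ-+ (bℕ ℕ.+ bℕ) (bℕ ℕ.+ bℕ)) (+-cong (fromℕ-+ bℕ bℕ) (fromℕ-+ bℕ bℕ))))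

  -- With f the quadratic polynomial, f(a + b) - f(x) = (a + b - x)(b + x), which explains the
  -- cofactor. At a root this equals f(a + b) = b(b + (p - 2)q), a positive number, so its first
  -- factor is apart from zero.
  a+b-root#0 : ∀ x → x * x - a * x - b ≈ 0# → a + b - x # 0#
  a+b-root#0 x root = x*y#0⇒x#0 (b + x) (#-congʳ (sym eq) (0<⇒#0
      (*-pos (0<fromℕ (p ℕ.* q)) (0<fromℕ (p ℕ.* q ℕ.+ p′ ℕ.* q)))))
    where
    eq : (a + b - x) * (b + x) ≈ b * fromℕ (p ℕ.* q ℕ.+ p′ ℕ.* q)
    eq = begin
      (a + b - x) * (b + x)
        ≈⟨ solve 3 (λ a b x → (a :+ b :- x) :* (b :+ x) := b :* (a :+ b :- con (+ 1)) :- (x :* x :- a :* x :- b)) refl a b x ⟩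
      b * (a + b - 1#) - (x * x - a * x - b)
        ≈⟨ +-cong (*-congˡ (+-congʳ (+-congʳ a≈))) (-‿cong root) ⟩
      b * (1# + P * Q + b - 1#) - 0#
        ≈⟨ solve 3 (λ b P Q → b :* (con (+ 1) :+ P :* Q :+ b :- con (+ 1)) :- con (+ 0) := b :* (b :+ P :* Q)) refl b P Q ⟩
      b * (b + P * Q)
        ≈⟨ *-congˡ (trans (fromℕ-+ (p ℕ.* q) (p′ ℕ.* q)) (+-congˡ (fromℕ-* p′ q))) ⟨
      b * fromℕ (p ℕ.* q ℕ.+ p′ ℕ.* q) ∎

  spectrum : ∃[ r₁ ] ∃[ r₂ ]
      ( r₁ # r₂
      × (∀ x → (x * x - a * x - b ≈ 0#) ⇔ (x ≈ r₁ ⊎ x ≈ r₂))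
      × (∀ x → Spectral.IsMainSeidelEigenvalue ℝ (hyperstar (suc p) (suc q) 2≤k) x ⇔ (x ≈ r₁ ⊎ x ≈ r₂)))
  spectrum =
    let l , l²≈D = SquareRoot.sqrt-fromℕ ℝ discriminant
        -- The square of l is the positive discriminant, and a factor of a product apart from zero
        -- is itself apart from zero.
        l#0      = x*y#0⇒x#0 l (#-congʳ (sym l²≈D) (0<⇒#0 (0<fromℕ discriminant)))
        r₁ , r₂ , r₁#r₂ , roots = quadratic-roots a b l l#0 (trans l²≈D fromℕ-discriminant)
    in r₁ , r₂ , r₁#r₂ , roots , λ x → mk⇔
        (λ main → Equivalence.to (roots x) (main⇒root main))
        (λ x≈r → let root = Equivalence.from (roots x) x≈r in root⇒main zero (a+b-root#0 x root) root)

  polynomial≈ : ∀ x → (x * x - ((fromℕ (suc q) - 1#) * (fromℕ (suc p) - fromℕ 3) + 1#) * x)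
                        - (fromℕ (suc p) - 1#) * (fromℕ (suc q) - 1#) ≈ x * x - a * x - b
  polynomial≈ x = trans
    (solve 3 (λ x P Q → (x :* x :- ((con (+ 1) :+ Q :- con (+ 1)) :* (con (+ 1) :+ (con (+ 1) :+ (con (+ 1) :+ P)) :- (con (+ 1) :+ (con (+ 1) :+ (con (+ 1) :+ con (+ 0))))) :+ con (+ 1)) :* x)
                        :- (con (+ 1) :+ (con (+ 1) :+ (con (+ 1) :+ P)) :- con (+ 1)) :* (con (+ 1) :+ Q :- con (+ 1))
                  := x :* x :- (con (+ 1) :+ P :* Q) :* x :- (con (+ 1) :+ (con (+ 1) :+ P)) :* Q) refl x P Q)
    (+-cong (+-congˡ (-‿cong (*-congʳ (sym a≈)))) (-‿cong (sym b≈)))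

theorem4p7 : ∀ {c ℓ₁ ℓ₂} (ℝ : RealField c ℓ₁ ℓ₂) → let open RealField ℝ in
    (n k : ℕ) → 3 ≤ n → (2≤k : 2 ≤ k) →
    ∃[ r₁ ] ∃[ r₂ ]
    ( r₁ # r₂
    × (∀ x → ((x * x - ((fromℕ k - 1#) * (fromℕ n - fromℕ 3) + 1#) * x)
    - (fromℕ n - 1#) * (fromℕ k - 1#) ≈ 0#)
    ⇔ (x ≈ r₁ ⊎ x ≈ r₂))
    × (∀ x → Spectral.IsMainSeidelEigenvalue ℝ (hyperstar n k 2≤k) x
    ⇔ (x ≈ r₁ ⊎ x ≈ r₂)) )
-- Matching on the bounds exposes n - 1 = p′ + 2 and k - 1 = q′ + 1, so both equivalences follow
-- from `spectrum`, the first after rewriting the polynomial.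
theorem4p7 ℝ (suc (suc (suc p′))) (suc (suc q′)) (s≤s (s≤s (s≤s z≤n))) 2≤k@(s≤s (s≤s z≤n)) =
  let r₁ , r₂ , r₁#r₂ , roots , mains = spectrum
  in r₁ , r₂ , r₁#r₂
   , (λ x → mk⇔ (λ eq → Equivalence.to (roots x) (trans (sym (polynomial≈ x)) eq))
                (λ x≈r → trans (polynomial≈ x) (Equivalence.from (roots x) x≈r)))
   , mains
  where
  open RealField ℝ using (trans; sym)
  open HyperstarSpectrum ℝ p′ q′ 2≤k
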